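{- Let $\mathcal{L}$ be a first order language, let $\mathcal{K}$ be a class of $\mathcal{L}$-structures closed under ultraproducts, and let $\mathbf{A}\leq\mathbf{B}$ be $\mathcal{L}$-structures (i.e. $\mathbf{A}$ is a substructure of $\mathbf{B}$). The following are equivalent: (1) $\mathbf{A}$ is an epic substructure of $\mathbf{B}$ in $\mathcal{K}$. (2) For every $b\in B$ there are a primitive positive $\mathcal{L}$-formula $\varphi(\bar{x},y)$ and a tuple $\bar{a}$ of elements of $A$ such that (a) $\varphi(\bar{x},y)$ defines a function in $\mathcal{K}$, and (b) $[\varphi]^{\mathbf{B}}(\bar{a})=b$, i.e. $\mathbf{B}\vDash\varphi(\bar{a},b)$.
   Context: For $\mathbf{A}\leq\mathbf{B}$, $\mathbf{A}$ is an epic substructure of $\mathbf{B}$ in $\mathcal{K}$ if for every $\mathbf{C}\in\mathcal{K}$ and all homomorphisms $g,g':\mathbf{B}\to\mathbf{C}$ with $g|_A=g'|_A$ we have $g=g'$. A primitive positive formula is one of the form $\exists\bar{z}\,\alpha(\bar{x},\bar{z})$ with $\alpha$ a finite conjunction of atomic formulas. A formula $\varphi(\bar{x},y)$ defines a function in $\mathcal{K}$ if $\mathcal{K}\vDash\forall\bar{x},y,z\ (\varphi(\bar{x},y)\wedge\varphi(\bar{x},z)\rightarrow y=z)$; in that case $[\varphi]^{\mathbf{C}}$ denotes the partial function defined by $\varphi$ in $\mathbf{C}\in\mathcal{K}$. The condition $[\varphi]^{\mathbf{B}}(\bar{a})=b$ means $\mathbf{B}\vDash\varphi(\bar{a},b)$.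 Here $A$, $B$ denote the universes of $\mathbf{A}$, $\mathbf{B}$. -}

module Defs where

open import Data.Fin.Base using (Fin; zero; suc)
open import Data.List.Base using (List)
open import Data.List.Relation.Unary.All using (All)
open import Data.Nat.Base using (ℕ; zero; suc; _+_)
open import Data.Product.Base using (Σ; _×_; _,_; proj₁; proj₂)
open import Data.Sum.Base using (_⊎_)
open import Data.Vec.Functional using (Vector; map; _∷_; _++_)
open import Data.Vec.Functional.Relation.Binary.Pointwise using (Pointwise)
open import Level using (Level; _⊔_) renaming (suc to lsuc)
open import Relation.Binary.Bundles using (Setoid)
open import Relation.Nullary.Negation.Core using (¬_)
open import Relation.Unary using (Pred; _∈_; _⊆_; _∩_; ∁)
open import Relation.Unary.Polymorphic using (∅; U)

private
  variable
    ℓ k : Level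

record Language ℓ : Set (lsuc ℓ) where
  field
    Fun      : Set ℓ
    Rel      : Set ℓ
    funArity : Fun → ℕ
    relArity : Rel → ℕ

-- The universe of a structure is a setoid whose equivalence interprets the
-- equality symbol, so that ultraproducts need no quotient types.  The universe
-- is allowed to be empty.
record Structure {ℓ} (L : Language ℓ) : Set (lsuc ℓ) where
  open Language L
  field
    universe : Setoid ℓ ℓ
  open Setoid universe public
  field
    fun      : (f : Fun) → Vector Carrier (funArity f) → Carrier
    fun-cong : ∀ f {xs ys} → Pointwise _≈_ xs ys → fun f xs ≈ fun f ys
    rel      : (R : Rel) → Pred (Vector Carrier (relArity R)) ℓ
    rel-resp : ∀ R {xs ys} → Pointwise _≈_ xs ys → rel R xs → rel R ys

record Hom {ℓ} {L : Language ℓ} (M N : Structure L) : Set ℓ where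
  open Language L
  private
    module M = Structure M
    module N = Structure N
  field
    ⟦_⟧      : M.Carrier → N.Carrier
    cong     : ∀ {x y} → x M.≈ y → ⟦ x ⟧ N.≈ ⟦ y ⟧
    pres-fun : ∀ f xs → ⟦ M.fun f xs ⟧ N.≈ N.fun f (map ⟦_⟧ xs)
    pres-rel : ∀ R xs → M.rel R xs → N.rel R (map ⟦_⟧ xs)

infix 4 _≈ʰ_

_≈ʰ_ : {L : Language ℓ} {M N : Structure L} → Hom M N → Hom M N → Set ℓ
_≈ʰ_ {M = M} {N} g h = ∀ x → Hom.⟦_⟧ g x ≈ Hom.⟦_⟧ h x
  where open Structure N using (_≈_)

-- A substructure is given by its universe, a subset closed under the
-- operations; the function and relation symbols are then interpreted by
-- restriction.
record Substructure {ℓ} {L : Language ℓ} (B : Structure L) : Set (lsuc ℓ) where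
  open Language L
  open Structure B
  field
    member : Pred Carrier ℓ
    resp   : ∀ {x y} → x ≈ y → x ∈ member → y ∈ member
    closed : ∀ f xs → (∀ i → xs i ∈ member) → fun f xs ∈ member

  structure : Structure L
  structure = record
    { universe = record
      { Carrier       = Σ Carrier member
      ; _≈_           = λ x y → proj₁ x ≈ proj₁ y
      ; isEquivalence = record { refl = refl ; sym = sym ; trans = trans }
      }
    ; fun      = λ f xs → fun f (map proj₁ xs) ,
                          closed f (map proj₁ xs) (λ i → proj₂ (xs i))
    ; fun-cong = λ f → fun-cong f
    ; rel      = λ R xs → rel R (map proj₁ xs)
    ; rel-resp = λ R → rel-resp R
    }

  inclusion : Hom structure B
  inclusion = record
    { ⟦_⟧      = proj₁
    ; cong     = λ x≈y → x≈y
    ; pres-fun = λ _ _ → refl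
    ; pres-rel = λ _ _ r → r
    }

infixl 6 _↾_

_↾_ : {L : Language ℓ} {B C : Structure L} → Hom B C →
      (A : Substructure B) → Hom (Substructure.structure A) C
g ↾ A = record
  { ⟦_⟧      = λ x → ⟦ proj₁ x ⟧
  ; cong     = cong
  ; pres-fun = λ f xs → pres-fun f (map proj₁ xs)
  ; pres-rel = λ R xs → pres-rel R (map proj₁ xs)
  }
  where open Hom g

Epic : {L : Language ℓ} → Pred (Structure L) k →
       {B : Structure L} → Substructure B → Set (lsuc ℓ ⊔ k)
Epic K {B} A = ∀ C → C ∈ K → (g g′ : Hom B C) → g ↾ A ≈ʰ g′ ↾ A → g ≈ʰ g′

module _ (L : Language ℓ) where
  open Language L

  data Term (n : ℕ) : Set ℓ where
    var : Fin n → Term n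
    app : (f : Fun) → Vector (Term n) (funArity f) → Term n

  data Atomic (n : ℕ) : Set ℓ where
    _≐_ : Term n → Term n → Atomic n
    rel : (R : Rel) → Vector (Term n) (relArity R) → Atomic n

  -- ∃ z̄ α(x̄, z̄), with n free variables x̄ numbered before the bound variables
  -- z̄; the list holds the conjuncts of α.
  record PPFormula (n : ℕ) : Set ℓ where
    constructor ∃∃
    field
      bound     : ℕ
      conjuncts : List (Atomic (n + bound))

module _ {L : Language ℓ} (M : Structure L) where
  open Structure M using (Carrier; _≈_; fun) renaming (rel to relᴹ)

  eval : ∀ {n} → Vector Carrier n → Term L n → Carrier
  eval ρ (var i)    = ρ i
  eval ρ (app f ts) = fun f (λ i → eval ρ (ts i))

  SatAtomic : ∀ {n} → Vector Carrier n → Atomic L n → Set ℓ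
  SatAtomic ρ (s ≐ t)    = eval ρ s ≈ eval ρ t
  SatAtomic ρ (rel R ts) = relᴹ R (λ i → eval ρ (ts i))

  infix 4 _⊨_[_]

  _⊨_[_] : ∀ {n} → PPFormula L n → Vector Carrier n → Set ℓ
  _⊨_[_] (∃∃ m α) ρ =
    Σ (Vector Carrier m) λ z → All (SatAtomic (ρ ++ z)) α

-- In a formula φ(x̄, y) with n + 1 free variables, y is variable number 0.
DefinesFunction : {L : Language ℓ} → Pred (Structure L) k →
                  ∀ {n} → PPFormula L (suc n) → Set (lsuc ℓ ⊔ k)
DefinesFunction K {n} φ =
  ∀ C → C ∈ K → let open Structure C in
  (x : Vector Carrier n) (y z : Carrier) →
  C ⊨ φ [ y ∷ x ] → C ⊨ φ [ z ∷ x ] → y ≈ z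

record IsUltrafilter {I : Set ℓ} (𝓤 : Pred (Pred I ℓ) ℓ) : Set (lsuc ℓ) where
  field
    univ   : U ∈ 𝓤
    proper : ¬ (∅ ∈ 𝓤)
    upward : ∀ {P Q} → P ⊆ Q → P ∈ 𝓤 → Q ∈ 𝓤
    inter  : ∀ {P Q} → P ∈ 𝓤 → Q ∈ 𝓤 → P ∩ Q ∈ 𝓤
    ultra  : ∀ P → P ∈ 𝓤 ⊎ ∁ P ∈ 𝓤

  inter-Fin : ∀ n (P : Fin n → Pred I ℓ) → (∀ j → P j ∈ 𝓤) →
              (λ i → ∀ j → P j i) ∈ 𝓤
  inter-Fin zero    P p = upward (λ _ ()) univ
  inter-Fin (suc n) P p = upward
    (λ { (h , t) zero → h ; (h , t) (suc j) → t j })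
    (inter (p zero) (inter-Fin n (λ j → P (suc j)) (λ j → p (suc j))))

module _ {L : Language ℓ} {I : Set ℓ} (C : I → Structure L)
         {𝓤 : Pred (Pred I ℓ) ℓ} (isUltrafilter : IsUltrafilter 𝓤) where
  open IsUltrafilter isUltrafilter
  private
    module C i = Structure (C i)

  ultraproduct : Structure L
  ultraproduct = record
    { universe = record
      { Carrier       = ∀ i → C.Carrier i
      ; _≈_           = λ x y → (λ i → C._≈_ i (x i) (y i)) ∈ 𝓤
      ; isEquivalence = record
        { refl  = upward (λ {i} _ → C.refl i) univ
        ; sym   = upward (λ {i} → C.sym i)
        ; trans = λ p q → upward (λ {i} (r , s) → C.trans i r s) (inter p q)
        }
      }
    ; fun      = λ f xs i → C.fun i f (λ j → xs j i)
    ; fun-cong = λ f p → upward (λ {i} → C.fun-cong i f) (inter-Fin _ _ p)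
    ; rel      = λ R xs → (λ i → C.rel i R (λ j → xs j i)) ∈ 𝓤
    ; rel-resp = λ R p q → upward (λ {i} (r , s) → C.rel-resp i R r s)
                                  (inter (inter-Fin _ _ p) q)
    }

ClosedUnderUltraproducts : {L : Language ℓ} → Pred (Structure L) k →
                           Set (lsuc ℓ ⊔ k)
ClosedUnderUltraproducts {ℓ} {L = L} K =
  {I : Set ℓ} (C : I → Structure L) {𝓤 : Pred (Pred I ℓ) ℓ}
  (isUltrafilter : IsUltrafilter 𝓤) →
  (∀ i → C i ∈ K) → ultraproduct C isUltrafilter ∈ K

{-# OPTIONS --safe #-}
module Submission where

-- (2) ⇒ (1): homomorphisms preserve primitive positive formulas.
-- (1) ⇒ (2): take a finite list Fs of instances of the positive diagram of B
-- together with elements of A.  It describes a primitive positive formula true of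
-- b in B, with parameters in A.  If no such formula defines a function in K, then
-- each Fs yields C ∈ K and two maps B → C which obey all of Fs, agree on the
-- listed elements of A, and differ at b.  Every condition belongs to some finite
-- list, so in an ultraproduct of these C over a suitable ultrafilter on the lists
-- the maps become homomorphisms that agree on A and differ at b.

open import Defs
open import Axiom.ExcludedMiddle using (ExcludedMiddle)
open import Axiom.Extensionality.Propositional using (Extensionality; lower-extensionality)
open import Data.Bool.Base using (Bool; true; false; T)
open import Data.Bool.Properties using (T?)
open import Data.Empty using (⊥; ⊥-elim)
open import Data.Fin.Base using (Fin; zero; suc; _↑ˡ_; _↑ʳ_)
import Data.List.Base as List
open import Data.List.Base using (List; []; concatMap)
open import Data.List.Membership.Propositional using () renaming (_∈_ to _∈ˡ_)
open import Data.List.Membership.Propositional.Properties using (∈-concatMap⁺)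
open import Data.List.Relation.Unary.All as All using (All; [])
import Data.List.Relation.Unary.All.Properties as Allₚ
open import Data.List.Relation.Unary.Any as Any using (here)
import Data.List.Relation.Unary.Any.Properties as Anyₚ
open import Data.Nat.Base using (ℕ; suc; _+_)
open import Data.Product.Base using (Σ; _×_; _,_; proj₁; proj₂)
open import Data.Sum.Base using (_⊎_; inj₁; inj₂)
open import Data.Unit.Polymorphic.Base using (tt)
open import Data.Vec.Functional.Properties using (lookup-++ˡ; lookup-++ʳ)
open import Data.Vec.Functional.Relation.Binary.Pointwise.Properties using (++⁺)
open import Function.Base using (_∘_)
open import Function.Bundles using (_⇔_; mk⇔)
open import Level using (Level; _⊔_; Lift; lift; lower; 0ℓ) renaming (suc to lsuc)
open import Relation.Binary.PropositionalEquality as ≡ using (_≡_; refl; sym; trans)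
open import Relation.Nullary.Decidable using (Dec; yes; no; isYes; map′; toWitness; fromWitness; decidable-stable)
open import Relation.Nullary.Negation using (¬_; contradiction)
open import Relation.Unary using (Pred; _∈_; _∩_; ∁)
open import Relation.Unary.Polymorphic using (∅; U)

-- Classical logic and Boolean truth values.

lower-em : ∀ {a} b → ExcludedMiddle (a ⊔ b) → ExcludedMiddle a
lower-em b em {P} = map′ lower lift (em {Lift b P})

T-injective : ∀ {x y} → (T x → T y) → (T y → T x) → x ≡ y
T-injective {true}  {true}  f g = refl
T-injective {true}  {false} f g = ⊥-elim (f _)
T-injective {false} {true}  f g = ⊥-elim (g _)
T-injective {false} {false} f g = refl

-- Boolean-valued subsets, since for these mutual inclusion yields propositional
-- equality, which makes choices out of a subset extensional.
module BooleanSubsets {ℓ} (em : ExcludedMiddle ℓ) where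

  Subset : Set ℓ → Set ℓ
  Subset X = X → Bool

  ⟨_⟩ : {X : Set ℓ} → Pred X ℓ → Subset X
  ⟨ P ⟩ x = isYes (em {P x})

  ⟨⟩⁺ : {X : Set ℓ} (P : Pred X ℓ) {x : X} → P x → T (⟨ P ⟩ x)
  ⟨⟩⁺ P = fromWitness

  ⟨⟩⁻ : {X : Set ℓ} (P : Pred X ℓ) {x : X} → T (⟨ P ⟩ x) → P x
  ⟨⟩⁻ P = toWitness

-- The Teichmüller–Tukey lemma for the property "all finite lists of elements
-- satisfy Φ", by the Bourbaki–Witt argument.
module Tukey {ℓ} (em : ExcludedMiddle ℓ) (ext : Extensionality ℓ 0ℓ)
             {X : Set ℓ} (Φ : Pred (List X) ℓ) where
  open BooleanSubsets em
  open import Data.List.Base using (_∷_)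
  open import Data.List.Relation.Unary.All using (_∷_)

  Consistent : ∀ {a} → Pred X a → Set (ℓ ⊔ a)
  Consistent P = ∀ xs → All P xs → Φ xs

  infix 4 _≼_

  _≼_ : Subset X → Subset X → Set ℓ
  F ≼ G = ∀ x → T (F x) → T (G x)

  ≼-antisym : ∀ {F G} → F ≼ G → G ≼ F → F ≡ G
  ≼-antisym p q = ext λ x → T-injective (p x) (q x)

  with-element : Subset X → X → Pred X ℓ
  with-element F x y = T (F y) ⊎ x ≡ y

  Extends : Subset X → Pred X ℓ
  Extends F x = ¬ T (F x) × Consistent (with-element F x)

  -- The decision is an argument so that proofs can split on it instead of on `em`.
  Chosen : ∀ {F} → Dec (Σ X (Extends F)) → Pred X ℓ
  Chosen (yes (x , _)) y = x ≡ y
  Chosen (no _)        y = Lift ℓ ⊥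

  Grown : Subset X → Pred X ℓ
  Grown F y = T (F y) ⊎ Chosen (em {Σ X (Extends F)}) y

  grow : Subset X → Subset X
  grow F = ⟨ Grown F ⟩

  grow-inflationary : ∀ F → F ≼ grow F
  grow-inflationary F x p = ⟨⟩⁺ (Grown F) (inj₁ p)

  module _ (F₀ : Subset X) where

    -- Including `F₀` makes the empty join `F₀`, so the tower starts there.
    Joined : Subset (Subset X) → Pred X ℓ
    Joined S x = T (F₀ x) ⊎ Σ (Subset X) λ F → T (S F) × T (F x)

    join : Subset (Subset X) → Subset X
    join S = ⟨ Joined S ⟩

    join-upper : ∀ S {F} → T (S F) → F ≼ join S
    join-upper S s x p = ⟨⟩⁺ (Joined S) (inj₂ (_ , s , p))

    join-least : ∀ S {G} → F₀ ≼ G → (∀ F → T (S F) → F ≼ G) → join S ≼ G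
    join-least S F₀≼G p x x∈ with ⟨⟩⁻ (Joined S) x∈
    ... | inj₁ q           = F₀≼G x q
    ... | inj₂ (F , s , q) = p F s x q

    -- Replaces transfinite iteration of `grow`. Boolean-valued families `S` keep it in `Set ℓ`, so
    -- that the whole tower can itself be joined.
    data Tower : Subset X → Set ℓ where
      grown  : ∀ {F} → Tower F → Tower (grow F)
      joined : ∀ S → (∀ F → T (S F) → Tower F) → Tower (join S)

    base≼ : ∀ {F} → Tower F → F₀ ≼ F
    base≼ (grown t)     x p = grow-inflationary _ x (base≼ t x p)
    base≼ (joined S ts) x p = ⟨⟩⁺ (Joined S) (inj₁ p)

    -- The extreme points of the Bourbaki-Witt argument, used to show that the tower is a chain.
    Extreme : Subset X → Set ℓ
    Extreme G = ∀ {F} → Tower F → F ≼ G → ¬ (G ≼ F) → grow F ≼ G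

    -- Induction on the tower below `F`: growing stays below `G` by extremality unless `F` equals
    -- `G`. A join lies above `grow G` if some member does; otherwise all members lie below `G`.
    compare : ∀ {F G} → Tower G → Extreme G → Tower F → F ≼ G ⊎ grow G ≼ F
    compare {G = G} tG e (grown {F} tF) with compare tG e tF
    ... | inj₂ p = inj₂ λ x q → grow-inflationary F x (p x q)
    ... | inj₁ p with em {G ≼ F}
    ...   | no ¬q = inj₁ (e tF p ¬q)
    ...   | yes q with ≼-antisym p q
    ...     | refl = inj₂ λ _ r → r
    compare {G = G} tG e (joined S ts)
      with em {Σ (Subset X) λ F → T (S F) × grow G ≼ F}
    ... | yes (F , s , p) = inj₂ λ x q → join-upper S s x (p x q)
    ... | no ¬p = inj₁ (join-least S (base≼ tG) below)
      where
      below : ∀ F → T (S F) → F ≼ G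
      below F s with compare tG e (ts F s)
      ... | inj₁ q = q
      ... | inj₂ q = contradiction (F , s , q) ¬p

    extreme : ∀ {G} → Tower G → Extreme G
    extreme (grown {G} tG) {F} tF p ¬q with compare tG (extreme tG) tF
    ... | inj₂ q = contradiction q ¬q
    ... | inj₁ r with em {G ≼ F}
    ...   | no ¬s = λ x q → grow-inflationary G x (extreme tG tF r ¬s x q)
    ...   | yes s with ≼-antisym r s
    ...     | refl = λ _ q → q
    extreme (joined S ts) {F} tF p ¬q
      with em {Σ (Subset X) λ G → T (S G) × F ≼ G}
    ... | no ¬r = contradiction (join-least S (base≼ tF) below) ¬q
      where
      below : ∀ G → T (S G) → G ≼ F
      below G s with compare (ts G s) (extreme (ts G s)) tF
      ... | inj₁ r = contradiction (G , s , r) ¬r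
      ... | inj₂ r = λ x q → r x (grow-inflationary G x q)
    ... | yes (G , s , r) with em {G ≼ F}
    ...   | no ¬t = λ x q → join-upper S s x (extreme (ts G s) tF r ¬t x q)
    ...   | yes t with ≼-antisym r t
    -- Now `F` is the member `G` itself, not strictly below it; comparing it with the join leaves
    -- only `grow F` below the join.
    ...     | refl with compare tF (extreme (ts G s)) (joined S ts)
    ...       | inj₁ u = contradiction u ¬q
    ...       | inj₂ u = u

    total : ∀ {F G} → Tower F → Tower G → F ≼ G ⊎ G ≼ F
    total {F} {G} tF tG with compare tG (extreme tG) tF
    ... | inj₁ p = inj₁ p
    ... | inj₂ p = inj₂ λ x q → p x (grow-inflationary G x q)

    -- In a chain, finitely many members of `S` have a largest; this reduces consistency of a join
    -- to that of its members and of `F₀`.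
    join-finite : ∀ S → (∀ F → T (S F) → Tower F) →
                  ∀ {xs} → All (T ∘ join S) xs →
                  All (T ∘ F₀) xs ⊎ Σ (Subset X) λ F → T (S F) × All (T ∘ F) xs
    join-finite S ts [] = inj₁ []
    join-finite S ts (p ∷ ps) with ⟨⟩⁻ (Joined S) p | join-finite S ts ps
    ... | inj₁ q           | inj₁ qs           = inj₁ (q ∷ qs)
    ... | inj₁ q           | inj₂ (F , s , qs) = inj₂ (F , s , base≼ (ts F s) _ q ∷ qs)
    ... | inj₂ (F , s , q) | inj₁ qs           =
      inj₂ (F , s , q ∷ All.map (λ {x} → base≼ (ts F s) x) qs)
    ... | inj₂ (F , s , q) | inj₂ (G , s′ , qs) with total (ts F s) (ts G s′)
    ...   | inj₁ r = inj₂ (G , s′ , r _ q ∷ qs)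
    ...   | inj₂ r = inj₂ (F , s , q ∷ All.map (λ {x} → r x) qs)

    module _ (consistent₀ : Consistent (T ∘ F₀)) where

      consistent : ∀ {F} → Tower F → Consistent (T ∘ F)
      consistent (grown {F} t) xs ps = helper (em {Σ X (Extends F)})
                                              (All.map (⟨⟩⁻ (Grown F)) ps)
        where
        helper : (d : Dec (Σ X (Extends F))) →
                 All (λ y → T (F y) ⊎ Chosen d y) xs → Φ xs
        helper (yes (x , _ , c)) qs = c xs qs
        helper (no _)            qs =
          consistent t xs (All.map (λ { (inj₁ q) → q ; (inj₂ ()) }) qs)
      consistent (joined S ts) xs ps with join-finite S ts ps
      ... | inj₁ qs           = consistent₀ xs qs
      ... | inj₂ (F , s , qs) = consistent (ts F s) xs qs

      -- The top of the tower; `grow` stays inside the tower, so it fixes the top.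
      maximal : Subset X
      maximal = join ⟨ Tower ⟩

      maximal-tower : Tower maximal
      maximal-tower = joined ⟨ Tower ⟩ λ F → ⟨⟩⁻ Tower

      maximal-fixed : grow maximal ≼ maximal
      maximal-fixed = join-upper ⟨ Tower ⟩ (⟨⟩⁺ Tower (grown maximal-tower))

      -- If `x` were missing, `grow` would add some new element, against the fixed point.
      maximal-maximal : ∀ x → Consistent (with-element maximal x) → T (maximal x)
      maximal-maximal x c =
        helper (em {Σ X (Extends maximal)})
               (λ y q → maximal-fixed y (⟨⟩⁺ (Grown maximal) (inj₂ q)))
        where
        helper : (d : Dec (Σ X (Extends maximal))) →
                 (∀ y → Chosen d y → T (maximal y)) → T (maximal x)
        helper (yes (y , ¬q , _)) p = contradiction (p y refl) ¬q
        helper (no ¬e)            p =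
          decidable-stable (T? _) λ ¬q → ¬e (x , ¬q , c)

-- Ultrafilters from the finite intersection property.

module _ {ℓ} (em : ExcludedMiddle ℓ) (ext : Extensionality ℓ 0ℓ) {I J : Set ℓ}
         (G : J → Pred I ℓ)
         (fip : ∀ js → Σ I λ i → All (λ j → i ∈ G j) js) where
  open BooleanSubsets em
  open import Data.List.Base using (_∷_)
  open import Data.List.Relation.Unary.All using (_∷_)

  private
    Meets : List (Subset I) → Set ℓ
    Meets ps = Σ I λ i → All (λ p → T (p i)) ps

    Generator : Pred (Subset I) ℓ
    Generator p = Σ J λ j → p ≡ ⟨ G j ⟩

    open Tukey em ext Meets

    generators-consistent : Consistent (T ∘ ⟨ Generator ⟩)
    generators-consistent ps qs =
      let js , f = indices qs
          i , m  = fip js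
      in i , f m
      where
      indices : ∀ {ps} → All (T ∘ ⟨ Generator ⟩) ps →
                Σ (List J) λ js → ∀ {i} → All (λ j → i ∈ G j) js →
                                  All (λ p → T (p i)) ps
      indices [] = [] , λ _ → []
      indices (q ∷ qs) with ⟨⟩⁻ Generator q | indices qs
      ... | j , refl | js , f = j ∷ js , λ { (m ∷ ms) → ⟨⟩⁺ (G j) m ∷ f ms }

    M : Subset (Subset I)
    M = maximal ⟨ Generator ⟩ generators-consistent

    M-consistent : Consistent (T ∘ M)
    M-consistent = consistent ⟨ Generator ⟩ generators-consistent
                     (maximal-tower ⟨ Generator ⟩ generators-consistent)

    M-maximal : ∀ p → Consistent (with-element M p) → T (M p)
    M-maximal = maximal-maximal ⟨ Generator ⟩ generators-consistent

    -- Discards the copies of `p`, leaving finitely many members of `M` to intersect with it.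
    split : ∀ {p ps} → All (with-element M p) ps →
            Σ (List (Subset I)) λ qs → All (T ∘ M) qs ×
              (∀ {i} → All (λ q → T (q i)) qs → T (p i) → All (λ q → T (q i)) ps)
    split [] = [] , [] , λ _ _ → []
    split (inj₁ m ∷ ms) with split ms
    ... | qs , ns , f = _ ∷ qs , m ∷ ns , λ { (r ∷ rs) s → r ∷ f rs s }
    split (inj₂ refl ∷ ms) with split ms
    ... | qs , ns , f = qs , ns , λ rs s → s ∷ f rs s

    -- Adding `q` keeps finite intersections inhabited, since a common point of members of `M` that
    -- include `ps` also lies in `q`; maximality then applies.
    M-closed : ∀ {ps q} → All (T ∘ M) ps →
               (∀ {i} → All (λ p → T (p i)) ps → T (q i)) → T (M q)
    M-closed {ps} {q} ms entails = M-maximal q λ rs r →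
      let qs , ns , f = split r
          i , all     = M-consistent (ps List.++ qs) (Allₚ.++⁺ ms ns)
      in i , f (Allₚ.++⁻ʳ ps all) (entails (Allₚ.++⁻ˡ ps all))

    𝓤 : Pred (Pred I ℓ) ℓ
    𝓤 P = Lift ℓ (T (M ⟨ P ⟩))

    -- If `P` is absent, maximality gives finitely many members of `M` whose intersection misses
    -- `P`, hence lies in its complement.
    𝓤-ultra : ∀ P → P ∈ 𝓤 ⊎ ∁ P ∈ 𝓤
    𝓤-ultra P with em {P ∈ 𝓤}
    ... | yes P∈ = inj₁ P∈
    ... | no P∉ with em {Σ _ λ ps → All (with-element M ⟨ P ⟩) ps × ¬ Meets ps}
    ...   | no ¬e = contradiction
      (lift (M-maximal ⟨ P ⟩ λ ps q → decidable-stable em λ ¬m → ¬e (ps , q , ¬m))) P∉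
    ...   | yes (ps , q , ¬m) =
      let qs , ns , f = split q
      in inj₂ (lift (M-closed ns λ rs → ⟨⟩⁺ (∁ P) λ p → ¬m (_ , f rs (⟨⟩⁺ P p))))

    𝓤-isUltrafilter : IsUltrafilter 𝓤
    𝓤-isUltrafilter = record
      { univ   = lift (M-closed [] λ {i} _ → ⟨⟩⁺ U {i} tt)
      ; proper = λ (lift m) → empty (M-consistent _ (m ∷ []))
      ; upward = λ {P} {Q} P⊆Q (lift m) →
          lift (M-closed (m ∷ []) λ { (p ∷ []) → ⟨⟩⁺ Q (P⊆Q (⟨⟩⁻ P p)) })
      ; inter  = λ {P} {Q} (lift m) (lift n) →
          lift (M-closed (m ∷ n ∷ []) λ { (p ∷ q ∷ []) → ⟨⟩⁺ (P ∩ Q) (⟨⟩⁻ P p , ⟨⟩⁻ Q q) })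
      ; ultra  = 𝓤-ultra
      }
      where
      empty : ¬ Meets (⟨ ∅ ⟩ ∷ [])
      empty (i , p ∷ []) = lower (⟨⟩⁻ ∅ {i} p)

  ultrafilter-lemma : Σ (Pred (Pred I ℓ) ℓ) λ 𝓤 → IsUltrafilter 𝓤 × (∀ j → G j ∈ 𝓤)
  ultrafilter-lemma = 𝓤 , 𝓤-isUltrafilter , λ j →
    lift (base≼ ⟨ Generator ⟩ (maximal-tower ⟨ Generator ⟩ generators-consistent) ⟨ G j ⟩
      (⟨⟩⁺ Generator (j , refl)))

-- Homomorphisms and primitive positive formulas.

open import Data.Vec.Functional using (Vector; map; _∷_; _++_)

module _ {ℓ} {L : Language ℓ} {B C : Structure L} (h : Hom B C) where
  open Language L
  open Hom h
  private
    module B = Structure B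
    module C = Structure C

  -- Only up to `≈`, so that the values of `g` at parameters can be exchanged for those of `h`.
  Image : ∀ {n} → Vector B.Carrier n → Vector C.Carrier n → Set ℓ
  Image ρ σ = ∀ i → ⟦ ρ i ⟧ C.≈ σ i

  eval-hom : ∀ {n} {ρ : Vector B.Carrier n} {σ} → Image ρ σ →
             (t : Term L n) → ⟦ eval B ρ t ⟧ C.≈ eval C σ t
  eval-hom im (var i)    = im i
  eval-hom im (app f ts) =
    C.trans (pres-fun f _) (C.fun-cong f λ i → eval-hom im (ts i))

  atomic-hom : ∀ {n} {ρ : Vector B.Carrier n} {σ} → Image ρ σ →
               (α : Atomic L n) → SatAtomic B ρ α → SatAtomic C σ α
  atomic-hom im (s ≐ t)    p =
    C.trans (C.sym (eval-hom im s)) (C.trans (cong p) (eval-hom im t))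
  atomic-hom im (rel R ts) p = C.rel-resp R (λ i → eval-hom im (ts i)) (pres-rel R _ p)

  pp-hom : ∀ {n} {ρ : Vector B.Carrier n} {σ} → Image ρ σ →
           (φ : PPFormula L n) → B ⊨ φ [ ρ ] → C ⊨ φ [ σ ]
  pp-hom im (∃∃ m αs) (z , p) =
    map ⟦_⟧ z ,
    All.map (λ {α} → atomic-hom (++⁺ (λ x y → ⟦ x ⟧ C.≈ y) im λ _ → C.refl) α) p

-- Definability and finite parts of the diagram.

module _ {ℓ k} {L : Language ℓ} (K : Pred (Structure L) k) {B : Structure L}
         (A : Substructure B) where
  open Language L
  private
    module B = Structure B
    module A = Structure (Substructure.structure A)

  PPDefinable : B.Carrier → Set (lsuc ℓ ⊔ k)
  PPDefinable b =
    Σ ℕ λ n →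
    Σ (PPFormula L (suc n)) λ φ →
    Σ (Vector A.Carrier n) λ a →
      DefinesFunction K φ × (B ⊨ φ [ b ∷ map proj₁ a ])

  definable⇒epic : (∀ b → PPDefinable b) → Epic K A
  definable⇒epic definable C C∈K g h agree b with definable b
  ... | n , φ , a , functional , sat =
    -- Both `g b` and `h b` are values of `φ` at the images of the parameters under `h`.
    functional C C∈K (map (Hom.⟦_⟧ h) (map proj₁ a)) _ _
      (pp-hom g (λ { zero → C.refl ; (suc j) → agree (a j) }) φ sat)
      (pp-hom h (λ { zero → C.refl ; (suc j) → C.refl }) φ sat)
    where module C = Structure C

  data Fact : Set ℓ where
    equal   : ∀ {x y} → x B.≈ y → Fact
    apply   : (f : Fun) (xs : Vector B.Carrier (funArity f)) → Fact
    related : (R : Rel) (xs : Vector B.Carrier (relArity R)) → B.rel R xs → Fact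
    member  : A.Carrier → Fact

  elements : Fact → List B.Carrier
  elements (equal {x} {y} _) = x List.∷ y List.∷ []
  elements (apply f xs)      = B.fun f xs List.∷ List.tabulate xs
  elements (related R xs _)  = List.tabulate xs
  elements (member _)        = []

  parameters : Fact → List A.Carrier
  parameters (member a) = a List.∷ []
  parameters _          = []

  module _ (C : Structure L) (g h : B.Carrier → Structure.Carrier C) where
    private module C = Structure C

    Holds : Fact → Set ℓ
    Holds (equal {x} {y} _) = g x C.≈ g y × h x C.≈ h y
    Holds (apply f xs)      = g (B.fun f xs) C.≈ C.fun f (map g xs) ×
                              h (B.fun f xs) C.≈ C.fun f (map h xs)
    Holds (related R xs _)  = C.rel R (map g xs) × C.rel R (map h xs)
    Holds (member (a , _))  = g a C.≈ h a

  Separates : B.Carrier → List Fact → Set (lsuc ℓ ⊔ k)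
  Separates b Fs =
    Σ (Structure L) λ C → C ∈ K ×
    Σ (B.Carrier → Structure.Carrier C) λ g →
    Σ (B.Carrier → Structure.Carrier C) λ h →
      All (Holds C g h) Fs × ¬ Structure._≈_ C (g b) (h b)

  -- Variables naming elements of `B`.

  module Naming (em : ExcludedMiddle ℓ) (b : B.Carrier)
                {n} (a : Vector A.Carrier n) {m} (z : Vector B.Carrier m) where

    -- Propositional equality suffices: `name` need not respect `≈`, because the `equal` facts
    -- impose what is required.
    Parameter : B.Carrier → Set ℓ
    Parameter c = Σ (Fin n) λ j → proj₁ (a j) ≡ c

    Bound : B.Carrier → Set ℓ
    Bound c = Σ (Fin m) λ j → z j ≡ c

    -- Parameters take precedence, so that elements of A are named by variables on
    -- which two witnesses against functionality agree; every element without
    -- another name is named by y.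
    choose : ∀ {c} → Dec (Parameter c) → Dec (Bound c) → Fin (suc n + m)
    choose (yes (j , _)) _             = suc j ↑ˡ m
    choose (no _)        (yes (j , _)) = suc n ↑ʳ j
    choose (no _)        (no _)        = zero

    name : B.Carrier → Fin (suc n + m)
    name c = choose (em {Parameter c}) (em {Bound c})

    ρ : Vector B.Carrier (suc n + m)
    ρ = (b ∷ map proj₁ a) ++ z

    -- An element that is neither a parameter nor bound gets the default `y`, whose value is correct
    -- only for `b`.
    ρ-name : ∀ {c} → Bound c ⊎ b ≡ c → ρ (name c) ≡ c
    ρ-name {c} named with em {Parameter c} | em {Bound c} | named
    ... | yes (j , p) | _           | _      =
      trans (lookup-++ˡ (b ∷ map proj₁ a) z (suc j)) p
    ... | no _        | yes (j , p) | _      =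
      trans (lookup-++ʳ (b ∷ map proj₁ a) z j) p
    ... | no _        | no ¬p       | inj₁ p = contradiction p ¬p
    ... | no _        | no _        | inj₂ p = p

    named : ∀ {c} → Bound c → c B.≈ ρ (name c)
    named p = B.reflexive (sym (ρ-name (inj₁ p)))

    parameter-agree : ∀ {X : Set ℓ} {y y′ : X} {x : Vector X n} {w w′ : Vector X m} {c} →
                      Parameter c → ((y ∷ x) ++ w) (name c) ≡ ((y′ ∷ x) ++ w′) (name c)
    parameter-agree {y = y} {y′} {x} {w} {w′} {c} pc with em {Parameter c}
    ... | yes (j , _) = trans (lookup-++ˡ (y ∷ x) w (suc j))
                              (sym (lookup-++ˡ (y′ ∷ x) w′ (suc j)))
    ... | no ¬p       = contradiction pc ¬p

    -- The conjunct of a member fact is a dummy: it is enforced by naming.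
    conjunct : Fact → Atomic L (suc n + m)
    conjunct (equal {x} {y} _) = var (name x) ≐ var (name y)
    conjunct (apply f xs)      = var (name (B.fun f xs)) ≐ app f λ i → var (name (xs i))
    conjunct (related R xs _)  = rel R λ i → var (name (xs i))
    conjunct (member _)        = var zero ≐ var zero

    conjunct-true : ∀ F → All Bound (elements F) → SatAtomic B ρ (conjunct F)
    conjunct-true (equal x≈y) (p All.∷ q All.∷ []) =
      B.trans (B.sym (named p)) (B.trans x≈y (named q))
    conjunct-true (apply f xs) (p All.∷ ps) =
      B.trans (B.sym (named p)) (B.fun-cong f λ i → named (Allₚ.tabulate⁻ ps i))
    conjunct-true (related R xs r) ps =
      B.rel-resp R (λ i → named (Allₚ.tabulate⁻ ps i)) r
    conjunct-true (member _) _ = B.refl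

  -- From epic substructures to defining formulas.

  module _ (em : ExcludedMiddle (lsuc ℓ ⊔ k)) where
    private
      em₀ : ExcludedMiddle ℓ
      em₀ = lower-em (lsuc ℓ ⊔ k) em

    separate : ∀ {b} → ¬ PPDefinable b → ∀ Fs → Separates b Fs
    -- Without two distinct values for the same parameters, `φ` would define a function and make `b`
    -- definable.
    separate {b} ¬definable Fs = separated (decidable-stable em λ ¬w →
        ¬definable (length as , φ , lookup as ,
          (λ C C∈K x y y′ p q → decidable-stable em₀ λ y≉y′ →
             ¬w (C , C∈K , x , y , y′ , p , q , y≉y′)) ,
          lookup cs , φ-true))
      where
      open import Data.List.Base using (length; lookup)
      as = concatMap parameters Fs
      cs = concatMap elements Fs

      open Naming em₀ b (lookup as) (lookup cs)

      φ : PPFormula L (suc (length as))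
      -- `b` may be named by a parameter or a bound variable; the extra conjunct ties that name to
      -- `y`, so that distinct values of `y` separate the maps at `b`.
      φ = ∃∃ (length cs) ((var zero ≐ var (name b)) List.∷ List.map conjunct Fs)

      listed : ∀ {a} {X Y : Set a} (f : X → List Y) {xs x y} → x ∈ˡ xs → y ∈ˡ f x →
               Σ (Fin (length (concatMap f xs))) λ j → lookup (concatMap f xs) j ≡ y
      listed f {y = y} x∈ y∈ =
        let y∈′ = ∈-concatMap⁺ f (Any.map (λ { refl → y∈ }) x∈)
        in Any.index y∈′ , sym (Anyₚ.lookup-index y∈′)

      φ-true : All (SatAtomic B ρ) (PPFormula.conjuncts φ)
      φ-true = B.reflexive (sym (ρ-name (inj₂ refl))) All.∷
        Allₚ.map⁺ (All.tabulate λ {F} F∈ →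
          conjunct-true F (All.tabulate (listed elements F∈)))

      Witness : Set (lsuc ℓ ⊔ k)
      Witness = Σ (Structure L) λ C → C ∈ K × let open Structure C in
        Σ (Vector Carrier (length as)) λ x → Σ Carrier λ y → Σ Carrier λ y′ →
          (C ⊨ φ [ y ∷ x ]) × (C ⊨ φ [ y′ ∷ x ]) × ¬ y ≈ y′

      separated : Witness → Separates b Fs
      separated (C , C∈K , x , y , y′ , (w , p All.∷ ps) , (w′ , q All.∷ qs) , y≉y′) =
        C , C∈K , g , h ,
        All.tabulate (λ {F} F∈ → holds F F∈ (All.lookup (Allₚ.map⁻ ps) F∈)
                                             (All.lookup (Allₚ.map⁻ qs) F∈)) ,
        λ gb≈hb → y≉y′ (C.trans p (C.trans gb≈hb (C.sym q)))
        where
        module C = Structure C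
        σ = (y ∷ x) ++ w
        τ = (y′ ∷ x) ++ w′
        g = λ c → σ (name c)
        h = λ c → τ (name c)

        holds : ∀ F → F ∈ˡ Fs → SatAtomic C σ (conjunct F) → SatAtomic C τ (conjunct F) →
                Holds C g h F
        holds (equal _)       _  r s = r , s
        holds (apply _ _)     _  r s = r , s
        holds (related _ _ _) _  r s = r , s
        holds (member a)      F∈ _ _ =
          let j , e = listed parameters F∈ (here refl)
          in C.reflexive (parameter-agree (j , ≡.cong proj₁ e))

    inseparable : Extensionality ℓ ℓ → ClosedUnderUltraproducts K → Epic K A →
                  ∀ {b} → ¬ (∀ Fs → Separates b Fs)
    inseparable ext closed epic {b} separated =
      -- Equality of `γ` and `η` at `b` would put a set with no indices into the ultrafilter.
      proper (upward (λ {Fs} gb≈hb → contradiction gb≈hb (distinct Fs))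
        (epic D (closed C isUltrafilter C∈K) γ η (λ a → holds (member a)) b))
      where
      C = λ Fs → proj₁ (separated Fs)
      C∈K = λ Fs → proj₁ (proj₂ (separated Fs))
      g = λ Fs → proj₁ (proj₂ (proj₂ (separated Fs)))
      h = λ Fs → proj₁ (proj₂ (proj₂ (proj₂ (separated Fs))))
      facts = λ Fs → proj₁ (proj₂ (proj₂ (proj₂ (proj₂ (separated Fs)))))
      distinct = λ Fs → proj₂ (proj₂ (proj₂ (proj₂ (proj₂ (separated Fs)))))

      -- The indices are the finite lists of facts. Any such list is itself an index whose maps obey
      -- all of its facts, which gives the finite intersection property.
      ultrafilter = ultrafilter-lemma em₀ (lower-extensionality ℓ ℓ ext)
                      (λ F Fs → Holds (C Fs) (g Fs) (h Fs) F) (λ Fs → Fs , facts Fs)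
      isUltrafilter = proj₁ (proj₂ ultrafilter)
      holds = proj₂ (proj₂ ultrafilter)
      open IsUltrafilter isUltrafilter

      D = ultraproduct C isUltrafilter

      γ : Hom B D
      γ = record
        { ⟦_⟧      = λ c Fs → g Fs c
        ; cong     = λ x≈y → upward proj₁ (holds (equal x≈y))
        ; pres-fun = λ f xs → upward proj₁ (holds (apply f xs))
        ; pres-rel = λ R xs r → upward proj₁ (holds (related R xs r))
        }

      η : Hom B D
      η = record
        { ⟦_⟧      = λ c Fs → h Fs c
        ; cong     = λ x≈y → upward proj₂ (holds (equal x≈y))
        ; pres-fun = λ f xs → upward proj₂ (holds (apply f xs))
        ; pres-rel = λ R xs r → upward proj₂ (holds (related R xs r))
        }

    epic⇒definable : Extensionality ℓ ℓ → ClosedUnderUltraproducts K →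
                     Epic K A → ∀ b → PPDefinable b
    epic⇒definable ext closed epic b = decidable-stable em λ ¬definable →
      inseparable ext closed epic (separate ¬definable)

theorem5 : ∀ {ℓ k : Level} →
    ExcludedMiddle (lsuc ℓ ⊔ k) → Extensionality ℓ ℓ →
    (L : Language ℓ) (K : Pred (Structure L) k) →
    ClosedUnderUltraproducts K →
    (B : Structure L) (A : Substructure B) →
    Epic K A
    ⇔
    ((b : Structure.Carrier B) →
    Σ ℕ λ n →
    Σ (PPFormula L (suc n)) λ φ →
    Σ (Vector (Structure.Carrier (Substructure.structure A)) n) λ a →
    DefinesFunction K φ ×
    (B ⊨ φ [ b ∷ map (Hom.⟦_⟧ (Substructure.inclusion A)) a ]))
theorem5 em ext L K closed B A =
  mk⇔ (epic⇒definable K A em ext closed) (definable⇒epic K A)
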